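{- Let $n\ge 1$ and $1<k\le 2n$. Suppose that for every 1D array of size $n$ there is an $S(n,k)$-bit encoding from which sorted 1-sided Top-$k$ queries can be answered. Then every $2\times n$ array $A$ admits an encoding of $2S(n,k)+\lceil 2n\lg 3\rceil+o(n)$ bits from which every sorted 3-sided Top-$k$ query on $A$ can be answered.
   Context: All arrays have pairwise distinct entries from a totally ordered set. For a 1D array $B[1..n]$ and $1\le i\le j\le n$, the query Top-$k(i,j,B)$ returns the positions of the $k$ largest values of $B[i..j]$ (all positions of $B[i..j]$ if it has at most $k$ entries); a query is sorted if the positions must be reported in decreasing order of their values, unsorted if in any order; 1-sided queries are those with $i=1$, 2-sided queries allow arbitrary $i\le j$. For an $m\times n$ array $A$, Top-$k(i,j,a,b,A)$ (with $1\le i\le j\le m$, $1\le a\le b\le n$) returns the positions of the $k$ largest values in the subarray $A[i..j][a..b]$; 3-sided queries are those with $a=1$, 4-sided queries allow arbitrary $a\le b$. An $s$-bit encoding supporting a family of queries is a map assigning to each array a bit string of length at most $s$ such that every query of the family can be answered from this bit string alone, without access to the array. -}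

module Defs where

open import Level using (Level; _⊔_)
open import Data.Bool.Base using (Bool)
open import Data.Fin.Base as Fin using (Fin; toℕ)
open import Data.Fin.Properties as Finₚ using ()
open import Data.Integer.Base using (+_)
open import Data.List.Base using (List; length; filter; allFin; cartesianProduct)
open import Data.List.Membership.Propositional using (_∈_; _∉_)
open import Data.List.Relation.Binary.Subset.Propositional using (_⊆_)
open import Data.List.Relation.Unary.AllPairs using (AllPairs)
open import Data.List.Relation.Unary.Unique.Propositional using (Unique)
open import Data.Nat.Base using (ℕ; _*_; _^_; _⊓_; _≤_)
open import Data.Nat.Logarithm using (⌈log₂_⌉)
open import Data.Product.Base using (_×_; _,_; ∃-syntax)
open import Data.Rational.Base as ℚ using (ℚ; _/_)
open import Data.Vec.Base using (Vec; lookup)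
open import Function.Definitions using (Injective)
open import Relation.Binary.Bundles using (TotalOrder)
open import Relation.Binary.PropositionalEquality.Core using (_≡_)
open import Relation.Nullary.Decidable using (_×-dec_)
import Relation.Binary.Construct.NonStrictToStrict as ToStrict

private
  variable
    a b c : Level

-- Indices count from 0, so the paper's [1..n] is Fin n.
record Interval (n : ℕ) : Set where
  constructor interval
  field
    lo hi : Fin n
    lo≤hi : lo Fin.≤ hi

StartsAtFirst : ∀ {n} → Interval n → Set
StartsAtFirst I = toℕ (Interval.lo I) ≡ 0

indices : ∀ {n} → Interval n → List (Fin n)
indices {n} I = filter (λ p → (lo Finₚ.≤? p) ×-dec (p Finₚ.≤? hi)) (allFin n)
  where open Interval I

Rectangle : ℕ → ℕ → Set
Rectangle m n = Interval m × Interval n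

cells : ∀ {m n} → Rectangle m n → List (Fin m × Fin n)
cells (I , J) = cartesianProduct (indices I) (indices J)

OneSided : ∀ {n} → Interval n → Set
OneSided = StartsAtFirst

-- The row range is arbitrary; only the column range has a fixed left end.
ThreeSided : ∀ {m n} → Rectangle m n → Set
ThreeSided (_ , J) = StartsAtFirst J

-- The decoder sees only the bit string and the query; parameters such as n
-- and k are fixed before the encoding is chosen.
record Encoding (s : ℕ) {Array : Set a} {Query Answer : Set}
                (InFamily : Query → Set b)
                (Correct : Array → Query → Answer → Set c)
                : Set (a ⊔ b ⊔ c) where
  field
    encode  : Array → List Bool
    bounded : ∀ A → length (encode A) ≤ s
    decode  : List Bool → Query → Answer
    correct : ∀ A q → InFamily q → Correct A q (decode (encode A) q)

module _ {ℓ₁ ℓ₂} (U : TotalOrder c ℓ₁ ℓ₂) where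
  open TotalOrder U using (Carrier; _≈_) renaming (_≤_ to _≤ᵁ_)
  open ToStrict _≈_ _≤ᵁ_ using () renaming (_<_ to _<ᵁ_)

  record Array₁ (n : ℕ) : Set (c ⊔ ℓ₁) where
    field
      entries  : Vec Carrier n
    value : Fin n → Carrier
    value = lookup entries
    field
      distinct : Injective _≡_ _≈_ value

  record Array₂ (m n : ℕ) : Set (c ⊔ ℓ₁) where
    field
      entries  : Vec (Vec Carrier n) m
    value : Fin m × Fin n → Carrier
    value (i , j) = lookup (lookup entries i) j
    field
      distinct : Injective _≡_ _≈_ value

  -- ps lists the positions of the k largest values among the positions R
  -- (all of R if it has at most k elements); R is assumed duplicate-free.
  record IsTopK {Pos : Set} (k : ℕ) (value : Pos → Carrier)
                (R ps : List Pos) : Set (c ⊔ ℓ₁ ⊔ ℓ₂) where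
    field
      unique  : Unique ps
      within  : ps ⊆ R
      size    : length ps ≡ k ⊓ length R
      largest : ∀ {p q} → p ∈ ps → q ∈ R → q ∉ ps → value q <ᵁ value p

  IsSortedTopK : {Pos : Set} (k : ℕ) (value : Pos → Carrier) →
                 (R ps : List Pos) → Set (c ⊔ ℓ₁ ⊔ ℓ₂)
  IsSortedTopK k value R ps =
    IsTopK k value R ps × AllPairs (λ p q → value q <ᵁ value p) ps

  SortedTopK₁ : ∀ {n} → ℕ → Array₁ n → Interval n → List (Fin n) →
                Set (c ⊔ ℓ₁ ⊔ ℓ₂)
  SortedTopK₁ k B I = IsSortedTopK k (Array₁.value B) (indices I)

  SortedTopK₂ : ∀ {m n} → ℕ → Array₂ m n → Rectangle m n →
                List (Fin m × Fin n) → Set (c ⊔ ℓ₁ ⊔ ℓ₂)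
  SortedTopK₂ k A Q = IsSortedTopK k (Array₂.value A) (cells Q)

  Sorted1SidedEncoding : (n k s : ℕ) → Set (c ⊔ ℓ₁ ⊔ ℓ₂)
  Sorted1SidedEncoding n k s = Encoding s (OneSided {n}) (SortedTopK₁ k)

  Sorted3SidedEncoding : (m n k s : ℕ) → Set (c ⊔ ℓ₁ ⊔ ℓ₂)
  Sorted3SidedEncoding m n k s = Encoding s (ThreeSided {m} {n}) (SortedTopK₂ k)

-- ⌈2n lg 3⌉, using 2n lg 3 = lg (3^(2n)).
⌈2_lg3⌉ : ℕ → ℕ
⌈2 n lg3⌉ = ⌈log₂ 3 ^ (2 * n) ⌉

-- e(n) = o(n); rational ε suffice, being dense in the positive reals.
IsLittleO[n] : (ℕ → ℕ) → Set
IsLittleO[n] e = ∀ (ε : ℚ) → ℚ.Positive ε →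
  ∃[ N ] (∀ n → N ≤ n → (+ e n) / 1 ℚ.≤ ε ℚ.* ((+ n) / 1))

{-# OPTIONS --safe #-}
module Submission where

-- Fix the top-k lists of both rows for every column prefix; then the top-k list
-- of the first t columns of A is their merge, determined by its word of row
-- labels. Going from t + 1 columns back to t, the surviving entries of the old
-- list form a prefix of the new one, and at most two entries are lost. So,
-- storing the whole word only for t = n and then just the labels of the newly
-- promoted entries, at most two labels are spent per column: 2n bits in all.
-- Together with the two row encodings, each padded to length S + 1 so that they can
-- be told apart, this fits, as 2 + 2n ≤ ⌈2n lg 3⌉; hence even o(n) = 0 works.

open import Defs
open import Data.Bool.Base using (Bool; true; false)
open import Data.Bool.Properties using () renaming (_≟_ to _≟ᵇ_)
open import Data.Fin.Base using (Fin; zero; suc; toℕ; fromℕ<)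
import Data.Fin.Properties as Finₚ
import Data.Integer.Base as ℤ
open import Data.List.Base
  using (List; []; _∷_; _++_; length; map; take; drop; filter; replicate; allFin; cartesianProduct)
open import Data.List.Membership.Propositional using (_∈_; _∉_)
open import Data.List.Membership.Propositional.Properties
  using (∈-∃++; ∈-++⁺ˡ; ∈-++⁺ʳ; ∈-++⁻; ∈-map⁺; ∈-map⁻; ∈-filter⁺; ∈-filter⁻;
         ∈-allFin; ∈-cartesianProduct⁺; ∈-cartesianProduct⁻)
open import Data.List.Properties
  using (length-++; length-map; length-take; length-replicate; length-filter;
         ∷-injective; ++-identityʳ; map-++; take++drop≡id; filter-++; filter-none)
open import Data.List.Relation.Binary.Permutation.Propositional using (_↭_; ↭-sym; ↭⇒↭ₛ)
open import Data.List.Relation.Binary.Permutation.Propositional.Properties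
  using (∈-resp-↭; ↭-length; filter-↭)
import Data.List.Relation.Binary.Permutation.Setoid.Properties as Permₛ
open import Data.List.Relation.Binary.Subset.Propositional using (_⊆_)
import Data.List.Relation.Unary.All as All
open import Data.List.Relation.Unary.AllPairs as AllPairs using (AllPairs; []; _∷_)
import Data.List.Relation.Unary.AllPairs.Properties as AllPairsₚ
open import Data.List.Relation.Unary.Any using (here; there)
import Data.List.Relation.Unary.Sorted.TotalOrder.Properties as Sortedₚ
open import Data.List.Relation.Unary.Unique.Propositional using (Unique)
import Data.List.Relation.Unary.Unique.Propositional.Properties as Uniqueₚ
import Data.List.Sort as Sort
open import Data.Nat.Base
  using (ℕ; zero; suc; _+_; _*_; _∸_; _^_; _⊓_; _≤_; _<_; z≤n; s≤s; s≤s⁻¹)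
open import Data.Nat.Logarithm using (⌈log₂_⌉; ⌈log₂⌉-mono-≤; ⌈log₂2^n⌉≡n)
open import Data.Nat.Properties
open import Algebra.Properties.CommutativeSemigroup +-commutativeSemigroup using (x∙yz≈y∙xz)
open import Data.Product.Base using (_×_; _,_; proj₁; proj₂; ∃-syntax)
open import Data.Product.Properties using (,-injectiveʳ) renaming (≡-dec to ×-≡-dec)
import Data.Rational.Base as ℚ
import Data.Rational.Properties as ℚₚ
open import Data.Sum.Base using (inj₁; inj₂)
open import Data.Vec.Base using (lookup)
open import Function.Base using (_∘_; flip)
open import Relation.Binary.Bundles using (TotalOrder; DecTotalOrder)
open import Relation.Binary.Consequences using (total∧dec⇒dec)
open import Relation.Binary.PropositionalEquality
  using (_≡_; _≢_; refl; sym; trans; cong; cong₂; subst; setoid; isEquivalence; module ≡-Reasoning)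
import Relation.Binary.Construct.NonStrictToStrict as ToStrict
open import Relation.Nullary.Decidable using (yes; no)
open import Relation.Nullary.Negation using (contradiction)
open import Relation.Unary using (Decidable; Pred)

-- Lists: prefixes, filters, and weaving two lists along a word.

module _ {A : Set} where

  length-mono-⊆ : {xs ys : List A} → Unique xs → xs ⊆ ys → length xs ≤ length ys
  length-mono-⊆ [] _ = z≤n
  length-mono-⊆ {x ∷ xs} (x∉ ∷ u) sub with ∈-∃++ (sub (here refl))
  ... | as , bs , refl = begin
    suc (length xs)              ≤⟨ s≤s (length-mono-⊆ u sub′) ⟩
    suc (length (as ++ bs))      ≡⟨ cong suc (length-++ as) ⟩
    suc (length as + length bs)  ≡⟨ +-suc (length as) (length bs) ⟨
    length as + suc (length bs)  ≡⟨ length-++ as ⟨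
    length (as ++ x ∷ bs)        ∎
    where
    open ≤-Reasoning
    sub′ : xs ⊆ as ++ bs
    sub′ z∈ with ∈-++⁻ as (sub (there z∈))
    ... | inj₁ z∈as         = ∈-++⁺ˡ z∈as
    ... | inj₂ (here refl)  = contradiction refl (All.lookup x∉ z∈)
    ... | inj₂ (there z∈bs) = ∈-++⁺ʳ as z∈bs

  infix 4 _≼_
  _≼_ : List A → List A → Set
  xs ≼ ys = ∃[ zs ] xs ++ zs ≡ ys

  ∷-≼ : ∀ {x xs ys} → xs ≼ ys → x ∷ xs ≼ x ∷ ys
  ∷-≼ (zs , refl) = zs , refl

  ≼-length : ∀ {xs ys} → xs ≼ ys → length xs ≤ length ys
  ≼-length {xs} (zs , refl) = subst (length xs ≤_) (sym (length-++ xs)) (m≤m+n _ _)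

  -- Reduces prefix claims to comparisons of lengths, once both lists are known to start a common
  -- list.
  ≼-comparable : ∀ {xs ys zs} → xs ≼ zs → ys ≼ zs → length xs ≤ length ys → xs ≼ ys
  ≼-comparable {[]} _ _ _ = _ , refl
  ≼-comparable {x ∷ xs} {y ∷ ys} (_ , refl) (_ , eq) (s≤s ≤) with ∷-injective eq
  ... | refl , eq′ = ∷-≼ (≼-comparable (_ , refl) (_ , eq′) ≤)

  take-≼ : ∀ k xs → take k xs ≼ xs
  take-≼ k xs = drop k xs , take++drop≡id k xs

  take-length : ∀ (xs : List A) {ys} → take (length xs) (xs ++ ys) ≡ xs
  take-length []       = refl
  take-length (x ∷ xs) = cong (x ∷_) (take-length xs)

  drop-length : ∀ (xs : List A) {ys} → drop (length xs) (xs ++ ys) ≡ ys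
  drop-length []       = refl
  drop-length (x ∷ xs) = drop-length xs

  length-take-≤ : ∀ k (xs : List A) → length (take k xs) ≤ k
  length-take-≤ k xs = subst (_≤ k) (sym (length-take k xs)) (m⊓n≤m k _)

  ≼-take : ∀ {k xs ys} → xs ≼ ys → length xs ≤ k → xs ≼ take k ys
  ≼-take {k} {xs} {ys} xs≼ys |xs|≤k = ≼-comparable xs≼ys (take-≼ k ys)
    (subst (length xs ≤_) (sym (length-take k ys)) (⊓-glb |xs|≤k (≼-length xs≼ys)))

  module _ {p} {P : Pred A p} (P? : Decidable P) where

    filter-≼ : ∀ {xs ys} → xs ≼ ys → filter P? xs ≼ filter P? ys
    filter-≼ {xs} (zs , refl) = filter P? zs , sym (filter-++ P? xs zs)

    filter-filter : ∀ {q} {Q : Pred A q} (Q? : Decidable Q) → (∀ {x} → P x → Q x) →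
                    ∀ xs → filter P? (filter Q? xs) ≡ filter P? xs
    filter-filter Q? P⇒Q [] = refl
    filter-filter Q? P⇒Q (x ∷ xs) with Q? x
    ... | yes _ with P? x
    ...   | yes _ = cong (x ∷_) (filter-filter Q? P⇒Q xs)
    ...   | no  _ = filter-filter Q? P⇒Q xs
    filter-filter Q? P⇒Q (x ∷ xs) | no ¬q with P? x
    ...   | yes p = contradiction (P⇒Q p) ¬q
    ...   | no  _ = filter-filter Q? P⇒Q xs

  -- The word names the list that supplies each next entry. The weave stops where the word ends, so
  -- surplus entries of either list are ignored; the last clause also covers a list that runs out
  -- too early.
  weave : List Bool → List A → List A → List A
  weave (false ∷ w) (x ∷ xs) ys       = x ∷ weave w xs ys
  weave (true  ∷ w) xs       (y ∷ ys) = y ∷ weave w xs ys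
  weave _           _        _        = []

  module _ (f : A → Bool) where

    side : Bool → List A → List A
    side b = filter (λ x → f x ≟ᵇ b)

    -- Prefixes are the right hypothesis: a row's own top-k list usually reaches deeper than its
    -- share of the merged list.
    weave-sides : ∀ zs {xs ys} → side false zs ≼ xs → side true zs ≼ ys →
                  weave (map f zs) xs ys ≡ zs
    weave-sides [] _ _ = refl
    weave-sides (z ∷ zs) p q with f z
    weave-sides (z ∷ zs) (_ , refl) q | false = cong (z ∷_) (weave-sides zs (_ , refl) q)
    weave-sides (z ∷ zs) p (_ , refl) | true  = cong (z ∷_) (weave-sides zs p (_ , refl))

-- Padding bit strings to a fixed length.

-- The first true marks where xs begins.
pad : ℕ → List Bool → List Bool
pad s xs = replicate (s ∸ length xs) false ++ true ∷ xs

unpad : List Bool → List Bool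
unpad []           = []
unpad (false ∷ xs) = unpad xs
unpad (true  ∷ xs) = xs

unpad-pad : ∀ s xs → unpad (pad s xs) ≡ xs
unpad-pad s xs = go (s ∸ length xs)
  where
  go : ∀ m → unpad (replicate m false ++ true ∷ xs) ≡ xs
  go zero    = refl
  go (suc m) = go m

length-pad : ∀ {s} xs → length xs ≤ s → length (pad s xs) ≡ suc s
length-pad {s} xs |xs|≤s = begin
  length (pad s xs)                                      ≡⟨ length-++ (replicate (s ∸ length xs) false) ⟩
  length (replicate (s ∸ length xs) false) + suc (length xs)
    ≡⟨ cong (_+ suc (length xs)) (length-replicate (s ∸ length xs)) ⟩
  s ∸ length xs + suc (length xs)                        ≡⟨ +-suc _ _ ⟩
  suc (s ∸ length xs + length xs)                        ≡⟨ cong suc (m∸n+n≡m |xs|≤s) ⟩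
  suc s                                                  ∎
  where open ≡-Reasoning

-- Sorted top-k lists as prefixes of a ranking.

module _ {c ℓ₁ ℓ₂} (U : TotalOrder c ℓ₁ ℓ₂) {Pos : Set} (value : Pos → TotalOrder.Carrier U) where

  open TotalOrder U using (antisym; module Eq) renaming (_≤_ to _≤ᵁ_; _≈_ to _≈ᵁ_)
  open ToStrict _≈ᵁ_ _≤ᵁ_ using () renaming (_<_ to _<ᵁ_)

  infix 4 _≻_
  _≻_ : Pos → Pos → Set _
  p ≻ q = value q <ᵁ value p

  ≻⇒≢ : ∀ {p q} → p ≻ q → p ≢ q
  ≻⇒≢ (_ , ≉) refl = ≉ Eq.refl

  ≻-asym : ∀ {p q} → p ≻ q → q ≻ p → ∀ {a} {A : Set a} → A
  ≻-asym (q≤p , q≉p) (p≤q , _) = contradiction (antisym q≤p p≤q) q≉p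

  ≻-sorted⇒unique : ∀ {zs} → AllPairs _≻_ zs → Unique zs
  ≻-sorted⇒unique = AllPairs.map ≻⇒≢

  -- The two heads must agree: otherwise the head of `ys` occurs later in `zs`, below the head of
  -- `zs`, although the latter is outside `ys`. Once the heads are removed, the hypotheses persist
  -- for the tails.
  upperSet-≼ : ∀ {ys zs} → AllPairs _≻_ zs → AllPairs _≻_ ys → ys ⊆ zs →
               (∀ {p q} → p ∈ ys → q ∈ zs → q ∉ ys → p ≻ q) → ys ≼ zs
  upperSet-≼ {[]} _ _ _ _ = _ , refl
  upperSet-≼ {y ∷ ys} {[]} _ _ ys⊆ _ = contradiction (ys⊆ (here refl)) λ ()
  upperSet-≼ {y ∷ ys} {z ∷ zs} (z≻ ∷ zs↘) (y≻ ∷ ys↘) ys⊆ largest with ys⊆ (here refl)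
  -- If `z` were in the tail of `ys`, then `y` would beat it, but `z` already beats `y`. So `z` is
  -- outside `ys` and must lose to `y`, a contradiction.
  ... | there y∈zs = ≻-asym z≻y (largest (here refl) (here refl) z∉)
    where
    z≻y = All.lookup z≻ y∈zs
    z∉ : z ∉ y ∷ ys
    z∉ (here refl)  = ≻⇒≢ z≻y refl
    z∉ (there z∈ys) = ≻-asym z≻y (All.lookup y≻ z∈ys)
  ... | here refl = ∷-≼ (upperSet-≼ zs↘ ys↘ ys⊆′ largest′)
    where
    ys⊆′ : ys ⊆ zs
    ys⊆′ p∈ with ys⊆ (there p∈)
    ... | here refl = contradiction refl (≻⇒≢ (All.lookup y≻ p∈))
    ... | there p∈zs = p∈zs
    largest′ : ∀ {p q} → p ∈ ys → q ∈ zs → q ∉ ys → p ≻ q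
    largest′ p∈ q∈ q∉ = largest (there p∈) (there q∈) λ where
      (here refl)  → ≻⇒≢ (All.lookup z≻ q∈) refl
      (there q∈ys) → q∉ q∈ys

  -- Needed for the row answers, which come from an arbitrary given encoding and are known only
  -- through their specification.
  sortedTopK-≼ : ∀ {k R ys zs} → AllPairs _≻_ zs → zs ⊆ R → R ⊆ zs →
                 IsSortedTopK U k value R ys → ys ≼ zs
  sortedTopK-≼ zs↘ zs⊆R R⊆zs (top , ys↘) =
    upperSet-≼ zs↘ ys↘ (R⊆zs ∘ within) (λ p∈ q∈ → largest p∈ (zs⊆R q∈))
    where open IsTopK top

  take-sortedTopK : ∀ {k R zs} → AllPairs _≻_ zs → Unique R → zs ⊆ R → R ⊆ zs →
                    IsSortedTopK U k value R (take k zs)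
  take-sortedTopK {k} {R} {zs} zs↘ R! zs⊆R R⊆zs = record
    { unique  = Uniqueₚ.take⁺ k zs!
    ; within  = zs⊆R ∘ subst (_ ∈_) (take++drop≡id k zs) ∘ ∈-++⁺ˡ
    -- `zs` and `R` are duplicate-free with the same members, hence equally long.
    ; size    = trans (length-take k zs)
        (cong (k ⊓_) (≤-antisym (length-mono-⊆ zs! zs⊆R) (length-mono-⊆ R! R⊆zs)))
    ; largest = λ p∈ q∈R q∉ → first≻rest (take k zs) split↘ p∈ (rest (R⊆zs q∈R) q∉)
    } , AllPairsₚ.take⁺ k zs↘
    where
    zs! = ≻-sorted⇒unique zs↘
    split↘ : AllPairs _≻_ (take k zs ++ drop k zs)
    split↘ = subst (AllPairs _≻_) (sym (take++drop≡id k zs)) zs↘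
    rest : ∀ {q} → q ∈ zs → q ∉ take k zs → q ∈ drop k zs
    rest q∈ q∉ with ∈-++⁻ (take k zs) (subst (_ ∈_) (sym (take++drop≡id k zs)) q∈)
    ... | inj₁ q∈take = contradiction q∈take q∉
    ... | inj₂ q∈drop = q∈drop
    first≻rest : ∀ xs {ys p q} → AllPairs _≻_ (xs ++ ys) → p ∈ xs → q ∈ ys → p ≻ q
    first≻rest (x ∷ xs) (x≻ ∷ _) (here refl) q∈ = All.lookup x≻ (∈-++⁺ʳ xs q∈)
    first≻rest (x ∷ xs) (_ ∷ ↘)  (there p∈)  q∈ = first≻rest xs ↘ p∈ q∈

  map-sortedTopK : ∀ {Pos′ : Set} {f : Pos′ → Pos} → (∀ {x y} → f x ≡ f y → x ≡ y) →
                   ∀ {k R ps} → IsSortedTopK U k (value ∘ f) R ps →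
                   IsSortedTopK U k value (map f R) (map f ps)
  map-sortedTopK {f = f} f-inj {k} {R} {ps} (top , ps↘) = record
    { unique  = Uniqueₚ.map⁺ f-inj unique
    ; within  = within′
    ; size    = trans (length-map f ps) (trans size (cong (k ⊓_) (sym (length-map f R))))
    ; largest = largest′
    } , AllPairsₚ.map⁺ ps↘
    where
    open IsTopK top
    within′ : map f ps ⊆ map f R
    within′ p∈ with ∈-map⁻ f p∈
    ... | _ , x∈ , refl = ∈-map⁺ f (within x∈)
    largest′ : ∀ {p q} → p ∈ map f ps → q ∈ map f R → q ∉ map f ps → p ≻ q
    largest′ p∈ q∈ q∉ with ∈-map⁻ f p∈ | ∈-map⁻ f q∈
    ... | _ , x∈ , refl | _ , y∈ , refl = largest x∈ y∈ (q∉ ∘ ∈-map⁺ f)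


-- Cells of a two-row array and their row labels.

Cell : ℕ → Set
Cell n = Fin 2 × Fin n

isSecondRow : ∀ {n} → Cell n → Bool
isSecondRow (zero  , _) = false
isSecondRow (suc _ , _) = true

rowIndex : Bool → Fin 2
rowIndex false = zero
rowIndex true  = suc zero

rowIndex-isSecondRow : ∀ {n} (p : Cell n) → rowIndex (isSecondRow p) ≡ proj₁ p
rowIndex-isSecondRow (zero     , _) = refl
rowIndex-isSecondRow (suc zero , _) = refl

isSecondRow-rowIndex : ∀ {n} b {j : Fin n} → isSecondRow (rowIndex b , j) ≡ b
isSecondRow-rowIndex false = refl
isSecondRow-rowIndex true  = refl

allCells : ∀ n → List (Cell n)
allCells n = cartesianProduct (allFin 2) (allFin n)

allCells-unique : ∀ n → Unique (allCells n)
allCells-unique n = Uniqueₚ.cartesianProduct⁺ (Uniqueₚ.allFin⁺ 2) (Uniqueₚ.allFin⁺ n)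

∈-allCells : ∀ {n} (p : Cell n) → p ∈ allCells n
∈-allCells (i , j) = ∈-cartesianProduct⁺ (∈-allFin i) (∈-allFin j)

_InFirst_ : ∀ {n} → Cell n → ℕ → Set
p InFirst t = toℕ (proj₂ p) < t

inFirst? : ∀ {n} t → Decidable {A = Cell n} (_InFirst t)
inFirst? t p = toℕ (proj₂ p) <? t

-- Decoding the merge, from the last column down.

module _ {n : ℕ} (k : ℕ) where

  upTo : ℕ → List (Cell n) → List (Cell n)
  upTo t = filter (inFirst? t)

  module _ (rowTop : Bool → ∀ t → .(t < n) → List (Cell n)) where

    -- The decoder must know how many labels to read without seeing the values. It does: the length
    -- of a top-k list depends only on `k` and the number of cells in its range.
    freshCount : ℕ → List (Cell n) → ℕ
    freshCount t known = k ⊓ length (upTo t (allCells n)) ∸ length known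

    -- Index `t` names the last column, so this is the list for `t + 1` columns. Known entries
    -- reveal their own row labels; only the fresh labels are read from `bits`.
    currentTop : ∀ t → .(t < n) → (bits : List Bool) (known : List (Cell n)) → List (Cell n)
    currentTop t t<n bits known = weave
      (map isSecondRow known ++ take (freshCount (suc t) known) bits)
      (rowTop false t t<n) (rowTop true t t<n)

    -- Invariant: known is a prefix of the top-k list of the first t columns, and
    -- bits starts with the rows of the remaining entries of that list.
    recover : ∀ t → .(t ≤ n) → (target : ℕ) (bits : List Bool) (known : List (Cell n)) →
              List (Cell n)
    -- A default value: targets are positive, so the recursion stops before reaching zero columns.
    recover zero    _   _      _    _     = []
    recover (suc t) t<n target bits known with suc t ≟ target
    ... | yes _ = currentTop t t<n bits known
    ... | no  _ = recover t (<⇒≤ t<n) target (drop (freshCount (suc t) known) bits)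
                    (upTo t (currentTop t t<n bits known))

  -- The encoder's label stream: its length and its correctness.

  -- ranking lists all cells by decreasing value.
  module _ (ranking : List (Cell n)) where

    top : ℕ → List (Cell n)
    top t = take k (upTo t ranking)

    -- The encoder's counterpart of `recover`: at each column count it emits labels only for the
    -- entries beyond `known`, then passes on the survivors as the next `known`.
    stream : ℕ → List (Cell n) → List Bool
    stream zero    known = []
    stream (suc t) known =
      map isSecondRow (drop (length known) (top (suc t))) ++ stream t (upTo t (top (suc t)))

    -- Deleting the last column only promotes entries from below, so what
    -- survives of one top-k list starts the next.
    upTo-top-≼ : ∀ t → upTo t (top (suc t)) ≼ top t
    upTo-top-≼ t = ≼-take
      (subst (upTo t (top (suc t)) ≼_)
        (filter-filter (inFirst? t) (inFirst? (suc t)) m<n⇒m<1+n ranking)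
        (filter-≼ (inFirst? t) (take-≼ k (upTo (suc t) ranking))))
      (≤-trans (length-filter (inFirst? t) (top (suc t))) (length-take-≤ k _))

    -- An entry that does not survive lies in column `t` exactly, and that column has two cells.
    length-top-suc : Unique ranking → ∀ t → length (top (suc t)) ≤ 2 + length (upTo t (top (suc t)))
    length-top-suc ranking! t with t <? n
    ... | yes t<n = length-mono-⊆
            (Uniqueₚ.take⁺ k (Uniqueₚ.filter⁺ (inFirst? (suc t)) ranking!)) split
      where
      split : top (suc t) ⊆
              (zero , fromℕ< t<n) ∷ (suc zero , fromℕ< t<n) ∷ upTo t (top (suc t))
      split {i , j} p∈ with toℕ j <? t
      ... | yes j<t = there (there (∈-filter⁺ (inFirst? t) p∈ j<t))
      ... | no j≮t = lastColumn i j≡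
        where
        p∈upTo : (i , j) ∈ upTo (suc t) ranking
        p∈upTo = subst (_ ∈_) (take++drop≡id k _) (∈-++⁺ˡ p∈)
        j≡ : j ≡ fromℕ< t<n
        j≡ = Finₚ.toℕ-injective (trans
          (≤-antisym (s≤s⁻¹ (proj₂ (∈-filter⁻ (inFirst? (suc t)) {xs = ranking} p∈upTo))) (≮⇒≥ j≮t))
          (sym (Finₚ.toℕ-fromℕ< t<n)))
        lastColumn : ∀ i {j} → j ≡ fromℕ< t<n → (i , j) ∈
              (zero , fromℕ< t<n) ∷ (suc zero , fromℕ< t<n) ∷ upTo t (top (suc t))
        lastColumn zero       refl = here refl
        lastColumn (suc zero) refl = there (here refl)
    -- There is no column `t`, so every entry survives.
    ... | no t≮n = ≤-trans (length-mono-⊆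
            (Uniqueₚ.take⁺ k (Uniqueₚ.filter⁺ (inFirst? (suc t)) ranking!))
            (λ p∈ → ∈-filter⁺ (inFirst? t) p∈ (<-≤-trans (Finₚ.toℕ<n _) (≮⇒≥ t≮n))))
            (m≤n+m _ 2)

    -- Counting `length known` as a credit makes the induction telescope: fresh and known entries
    -- together form the current top-k list, which exceeds its survivors by at most two, and the
    -- survivors are the credit of the next stage.
    length-stream : Unique ranking → ∀ t {known} → known ≼ top t →
                    length (stream t known) + length known ≤ 2 * t
    length-stream ranking! zero {known} known≼ = ≤-trans (≼-length known≼)
      (subst (λ xs → length (take k xs) ≤ 0)
        (sym (filter-none (inFirst? 0) (All.universal (λ _ ()) ranking)))
        (≤-reflexive (trans (length-take k []) (⊓-zeroʳ k))))
    length-stream ranking! (suc t) {known} (new , eq) = begin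
      length (stream (suc t) known) + length known
        ≡⟨ cong (_+ length known) (length-++ (map isSecondRow (drop (length known) (top (suc t))))) ⟩
      length (map isSecondRow (drop (length known) (top (suc t)))) + s + length known
        ≡⟨ cong (λ xs → length xs + s + length known) rows≡ ⟩
      length (map isSecondRow new) + s + length known
        ≡⟨ cong (λ l → l + s + length known) (length-map isSecondRow new) ⟩
      length new + s + length known
        ≡⟨ cong (_+ length known) (+-comm (length new) s) ⟩
      s + length new + length known
        ≡⟨ +-assoc s (length new) (length known) ⟩
      s + (length new + length known)
        ≡⟨ cong (s +_) (trans (+-comm (length new) (length known))
             (trans (sym (length-++ known)) (cong length eq))) ⟩
      s + length (top (suc t))
        ≤⟨ +-monoʳ-≤ s (length-top-suc ranking! t) ⟩
      s + (2 + length (upTo t (top (suc t))))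
        ≡⟨ x∙yz≈y∙xz s 2 _ ⟩
      2 + (s + length (upTo t (top (suc t))))
        ≤⟨ +-monoʳ-≤ 2 (length-stream ranking! t (upTo-top-≼ t)) ⟩
      2 + 2 * t
        ≡⟨ *-suc 2 t ⟨
      2 * suc t ∎
      where
      open ≤-Reasoning
      s = length (stream t (upTo t (top (suc t))))
      rows≡ : map isSecondRow (drop (length known) (top (suc t))) ≡ map isSecondRow new
      rows≡ = cong (map isSecondRow)
        (trans (cong (drop (length known)) (sym eq)) (drop-length known))

    module _ (rowTop : Bool → ∀ t → .(t < n) → List (Cell n))
             (ranking↭ : ranking ↭ allCells n)
             (side-≼ : ∀ b t .(t<n : t < n) → side isSecondRow b (top (suc t)) ≼ rowTop b t t<n)
             where

      module _ (t : ℕ) {known new} (eq : known ++ new ≡ top (suc t)) where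

        -- The ranking permutes `allCells n`, so the decoder's count over `allCells n` agrees with
        -- the length of the encoder's list.
        freshCount-≡ : freshCount rowTop (suc t) known ≡ length (map isSecondRow new)
        freshCount-≡ = begin
          k ⊓ length (upTo (suc t) (allCells n)) ∸ length known
            ≡⟨ cong (λ l → k ⊓ l ∸ length known)
                 (↭-length (filter-↭ (inFirst? (suc t)) ranking↭)) ⟨
          k ⊓ length (upTo (suc t) ranking) ∸ length known
            ≡⟨ cong (_∸ length known) (length-take k _) ⟨
          length (top (suc t)) ∸ length known
            ≡⟨ cong (λ xs → length xs ∸ length known) eq ⟨
          length (known ++ new) ∸ length known
            ≡⟨ cong (_∸ length known) (length-++ known) ⟩
          length known + length new ∸ length known
            ≡⟨ m+n∸m≡n (length known) (length new) ⟩
          length new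
            ≡⟨ length-map isSecondRow new ⟨
          length (map isSecondRow new) ∎
          where open ≡-Reasoning

        stream-≡ : stream (suc t) known ≡
                   map isSecondRow new ++ stream t (upTo t (top (suc t)))
        stream-≡ = cong (λ xs → map isSecondRow xs ++ stream t (upTo t (top (suc t))))
          (trans (cong (drop (length known)) (sym eq)) (drop-length known))

        currentTop-≡ : ∀ .(t<n : t < n) →
                       currentTop rowTop t t<n (stream (suc t) known) known ≡ top (suc t)
        -- The rewrites turn the labels of `known` followed by those read from the stream into the
        -- label word of the whole list `top (suc t)`.
        currentTop-≡ t<n rewrite freshCount-≡ | stream-≡
          | take-length (map isSecondRow new) {stream t (upTo t (top (suc t)))}
          | sym (map-++ isSecondRow known new) | eq =
          weave-sides isSecondRow (top (suc t)) (side-≼ false t t<n) (side-≼ true t t<n)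

        drop-stream : drop (freshCount rowTop (suc t) known) (stream (suc t) known) ≡
                      stream t (upTo t (top (suc t)))
        drop-stream rewrite freshCount-≡ | stream-≡ = drop-length (map isSecondRow new)

      -- Encoder and decoder stay synchronised: after each stage both hold the same survivors, again
      -- a prefix of the next list by `upTo-top-≼`, and the unread bits are exactly the remaining
      -- stream.
      recover-top : ∀ t .(t≤n : t ≤ n) {target known} → target ≤ t → 0 < target → known ≼ top t →
                    recover rowTop t t≤n target (stream t known) known ≡ top target
      recover-top zero    _   target≤0 0<target _ = contradiction (<-≤-trans 0<target target≤0) λ ()
      recover-top (suc t) t<n {target} {known} target≤ 0<target (new , eq) with suc t ≟ target
      ... | yes refl = currentTop-≡ t {known} {new} eq t<n
      ... | no  t+1≢ = trans
        (cong₂ (λ bits xs → recover rowTop t (<⇒≤ t<n) target bits (upTo t xs))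
          (drop-stream t {known} {new} eq) (currentTop-≡ t {known} {new} eq t<n))
        (recover-top t (<⇒≤ t<n) (s≤s⁻¹ (≤∧≢⇒< target≤ (t+1≢ ∘ sym))) 0<target (upTo-top-≼ t))

-- Intervals that start at the first column.

module _ {n : ℕ} (I : Interval n) where

  open Interval I

  ∈-indices⁺ : StartsAtFirst I → ∀ {j} → toℕ j < suc (toℕ hi) → j ∈ indices I
  ∈-indices⁺ lo≡0 {j} j≤hi =
    ∈-filter⁺ _ (∈-allFin j) (subst (_≤ toℕ j) (sym lo≡0) z≤n , s≤s⁻¹ j≤hi)

  ∈-indices⁻ : ∀ {j} → j ∈ indices I → toℕ j < suc (toℕ hi)
  ∈-indices⁻ j∈ = s≤s (proj₂ (proj₂ (∈-filter⁻ _ {xs = allFin n} j∈)))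

  indices-unique : Unique (indices I)
  indices-unique = Uniqueₚ.filter⁺ _ (Uniqueₚ.allFin⁺ n)

-- `t` is the index of the last column, so there are `t + 1` columns.
firstColumns : ∀ {m} t → .(t < suc m) → Interval (suc m)
firstColumns t t<n = interval zero (fromℕ< t<n) z≤n

-- Ranking the cells and assembling the encoding.

module _ {c ℓ₁ ℓ₂} (U : TotalOrder c ℓ₁ ℓ₂) where

  open TotalOrder U using (antisym; total)
    renaming (_≤_ to _≤ᵁ_; refl to ≤ᵁ-refl; trans to ≤ᵁ-trans)

  module _ {n : ℕ} (A : Array₂ U 2 n) where

    open Array₂ A

    rowArray : Fin 2 → Array₁ U n
    rowArray i = record
      { entries  = lookup entries i
      ; distinct = ,-injectiveʳ ∘ distinct
      }

    descending : DecTotalOrder _ _ _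
    descending = record
      { Carrier = Cell n
      ; _≈_ = _≡_
      ; _≤_ = λ p q → value q ≤ᵁ value p
      ; isDecTotalOrder = record
        { isTotalOrder = record
          { isPartialOrder = record
            { isPreorder = record
              { isEquivalence = isEquivalence
              ; reflexive = ≤-reflexive′
              ; trans = flip ≤ᵁ-trans
              }
            ; antisym = antisym′
            }
          ; total = λ p q → total (value q) (value p)
          }
        ; _≟_ = _≟ᶜ_
        -- `U` provides no decision procedure. Totality gives one direction, and if that is the
        -- wrong one, distinctness reduces the question to equality of cells, which is decidable.
        ; _≤?_ = total∧dec⇒dec ≤-reflexive′ antisym′ (λ p q → total (value q) (value p)) _≟ᶜ_
        }
      }
      where
      _≟ᶜ_ = ×-≡-dec Finₚ._≟_ Finₚ._≟_
      ≤-reflexive′ : ∀ {p q} → p ≡ q → value q ≤ᵁ value p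
      ≤-reflexive′ refl = ≤ᵁ-refl
      antisym′ : ∀ {p q} → value q ≤ᵁ value p →
                 value p ≤ᵁ value q → p ≡ q
      antisym′ q≤p p≤q = distinct (antisym p≤q q≤p)

    open Sort descending

    cellRanking : List (Cell n)
    cellRanking = sort (allCells n)

    cellRanking-↭ : cellRanking ↭ allCells n
    cellRanking-↭ = sort-↭ (allCells n)

    cellRanking-unique : Unique cellRanking
    cellRanking-unique =
      Permₛ.Unique-resp-↭ (setoid _) (↭⇒↭ₛ (↭-sym cellRanking-↭)) (allCells-unique n)

    ∈-cellRanking : ∀ p → p ∈ cellRanking
    ∈-cellRanking p = ∈-resp-↭ (↭-sym cellRanking-↭) (∈-allCells p)

    cellRanking-sorted : AllPairs (_≻_ U value) cellRanking
    cellRanking-sorted = AllPairs.zipWith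
      (λ (q≤p , p≢q) → q≤p , λ q≈p → p≢q (sym (distinct q≈p)))
      ( Sortedₚ.Sorted⇒AllPairs (DecTotalOrder.totalOrder descending) (sort-↗ (allCells n))
      , cellRanking-unique )

  module _ {m k s : ℕ} (rows : Sorted1SidedEncoding U (suc m) k s) where

    open Encoding rows

    private
      n = suc m

    rowAnswer : (bits₀ bits₁ : List Bool) → Bool → Interval n → List (Cell n)
    rowAnswer bits₀ bits₁ false J = map (zero ,_) (decode bits₀ J)
    rowAnswer bits₀ bits₁ true  J = map (suc zero ,_) (decode bits₁ J)

    rowPrefixAnswer : (bits₀ bits₁ : List Bool) → Bool → ∀ t → .(t < n) → List (Cell n)
    rowPrefixAnswer bits₀ bits₁ b t t<n = rowAnswer bits₀ bits₁ b (firstColumns t t<n)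

    answer : (bits₀ bits₁ bits : List Bool) → Rectangle 2 n → List (Cell n)
    answer bits₀ bits₁ bits (interval zero       zero       _ , J) = rowAnswer bits₀ bits₁ false J
    answer bits₀ bits₁ bits (interval (suc zero) (suc zero) _ , J) = rowAnswer bits₀ bits₁ true J
    answer bits₀ bits₁ bits (interval zero       (suc zero) _ , J) =
      -- The walk starts at all `n` columns with nothing known; `suc` turns the last column's index
      -- into a column count.
      recover k (rowPrefixAnswer bits₀ bits₁) n ≤-refl (suc (toℕ (Interval.hi J))) bits []

    module _ (A : Array₂ U 2 n) where

      open Array₂ A

      rowBits : Fin 2 → List Bool
      rowBits i = encode (rowArray A i)

      mergeBits : List Bool
      mergeBits = stream k (cellRanking A) n []

      rowAnswer-sortedTopK : ∀ b J → OneSided J →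
        IsSortedTopK U k value (map (rowIndex b ,_) (indices J))
          (rowAnswer (rowBits zero) (rowBits (suc zero)) b J)
      rowAnswer-sortedTopK false J J₁ =
        map-sortedTopK U value ,-injectiveʳ (correct (rowArray A zero) J J₁)
      rowAnswer-sortedTopK true  J J₁ =
        map-sortedTopK U value ,-injectiveʳ (correct (rowArray A (suc zero)) J J₁)

      -- Both lists are prefixes of `zs`, the row's own ranking of these columns, so lengths decide.
      -- The row's share of the merged list has at most `k` and at most `length R` entries, and the
      -- row answer has exactly the minimum of the two.
      side-top-≼ : ∀ b t .(t<n : t < n) → side isSecondRow b (top k (cellRanking A) (suc t)) ≼
                   rowPrefixAnswer (rowBits zero) (rowBits (suc zero)) b t t<n
      side-top-≼ b t t<n = ≼-comparable
        top-side≼zs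
        (sortedTopK-≼ U value zs↘ zs⊆R R⊆zs row-topK)
        (begin
          length (side isSecondRow b (top k (cellRanking A) (suc t)))
            ≤⟨ ⊓-glb
                 (≤-trans (length-filter inRow? (top k (cellRanking A) (suc t)))
                   (length-take-≤ k (upTo k (suc t) (cellRanking A))))
                 (≤-trans (≼-length top-side≼zs)
                   (length-mono-⊆ (≻-sorted⇒unique U value zs↘) zs⊆R)) ⟩
          k ⊓ length R
            ≡⟨ IsTopK.size (proj₁ row-topK) ⟨
          length (rowPrefixAnswer (rowBits zero) (rowBits (suc zero)) b t t<n) ∎)
        where
        open ≤-Reasoning
        J = firstColumns t t<n
        R = map (rowIndex b ,_) (indices J)
        inRow? = λ (p : Cell n) → isSecondRow p ≟ᵇ b
        zs = side isSecondRow b (upTo k (suc t) (cellRanking A))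
        top-side≼zs : side isSecondRow b (top k (cellRanking A) (suc t)) ≼ zs
        top-side≼zs = filter-≼ inRow? (take-≼ k (upTo k (suc t) (cellRanking A)))
        zs↘ : AllPairs (_≻_ U value) zs
        zs↘ = AllPairsₚ.filter⁺ inRow? (AllPairsₚ.filter⁺ (inFirst? (suc t)) (cellRanking-sorted A))
        row-topK = rowAnswer-sortedTopK b J refl
        hi≡ : suc (toℕ (fromℕ< t<n)) ≡ suc t
        hi≡ = cong suc (Finₚ.toℕ-fromℕ< t<n)
        zs⊆R : zs ⊆ R
        zs⊆R {p@(i , j)} p∈ with ∈-filter⁻ inRow? {xs = upTo k (suc t) (cellRanking A)} p∈
        ... | p∈upTo , refl = subst (λ i → (i , j) ∈ R) (rowIndex-isSecondRow p)
          (∈-map⁺ _ (∈-indices⁺ J refl (subst (toℕ j <_) (sym hi≡)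
            (proj₂ (∈-filter⁻ (inFirst? (suc t)) {xs = cellRanking A} p∈upTo)))))
        R⊆zs : R ⊆ zs
        R⊆zs p∈ with ∈-map⁻ _ p∈
        ... | j , j∈ , refl = ∈-filter⁺ inRow?
          (∈-filter⁺ (inFirst? (suc t)) (∈-cellRanking A _)
            (subst (toℕ j <_) hi≡ (∈-indices⁻ J j∈)))
          (isSecondRow-rowIndex b)

      top-sortedTopK : ∀ {0≤1} J → OneSided J →
        SortedTopK₂ U k A (interval zero (suc zero) 0≤1 , J)
          (top k (cellRanking A) (suc (toℕ (Interval.hi J))))
      top-sortedTopK {0≤1} J J₁ = take-sortedTopK U value
        (AllPairsₚ.filter⁺ (inFirst? t) (cellRanking-sorted A))
        (Uniqueₚ.cartesianProduct⁺ (indices-unique bothRows) (indices-unique J))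
        -- `indices bothRows` computes to `allFin 2`.
        (λ p∈ → ∈-cartesianProduct⁺ (∈-allFin _)
          (∈-indices⁺ J J₁ (proj₂ (∈-filter⁻ (inFirst? t) {xs = cellRanking A} p∈))))
        (λ p∈ → ∈-filter⁺ (inFirst? t) (∈-cellRanking A _)
          (∈-indices⁻ J (proj₂ (∈-cartesianProduct⁻ (indices bothRows) (indices J) p∈))))
        where
        t = suc (toℕ (Interval.hi J))
        bothRows = interval zero (suc zero) 0≤1

      answer-sortedTopK : ∀ Q → ThreeSided Q →
        SortedTopK₂ U k A Q (answer (rowBits zero) (rowBits (suc zero)) mergeBits Q)
      answer-sortedTopK (interval zero zero _ , J) J₁
        = subst (λ R → IsSortedTopK U k value R (rowAnswer (rowBits zero) (rowBits (suc zero)) false J))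
            -- The product with a single row computes to that row's cells followed by an empty list.
            (sym (++-identityʳ _)) (rowAnswer-sortedTopK false J J₁)
      answer-sortedTopK (interval (suc zero) (suc zero) _ , J) J₁
        = subst (λ R → IsSortedTopK U k value R (rowAnswer (rowBits zero) (rowBits (suc zero)) true J))
            (sym (++-identityʳ _)) (rowAnswer-sortedTopK true J J₁)
      answer-sortedTopK Q@(interval zero (suc zero) 0≤1 , J) J₁ =
        subst (SortedTopK₂ U k A Q)
          (sym (recover-top k (cellRanking A) (rowPrefixAnswer (rowBits zero) (rowBits (suc zero)))
            (cellRanking-↭ A) side-top-≼ n ≤-refl {known = []}
            (Finₚ.toℕ<n (Interval.hi J)) (s≤s z≤n) (_ , refl)))
          (top-sortedTopK {0≤1} J J₁)

    -- The fixed length `suc s` of the padded row strings gives the decoder both cut points; the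
    -- merge labels come last and need no delimiter.
    threeSided : Sorted3SidedEncoding U 2 n k (2 * suc s + 2 * n)
    threeSided = record
      { encode  = λ A → padded A zero ++ padded A (suc zero) ++ mergeBits A
      ; bounded = λ A → begin
          length (padded A zero ++ padded A (suc zero) ++ mergeBits A)
            ≡⟨ length-++ (padded A zero) ⟩
          length (padded A zero) + length (padded A (suc zero) ++ mergeBits A)
            ≡⟨ cong₂ _+_ (length-padded A zero) (length-++ (padded A (suc zero))) ⟩
          suc s + (length (padded A (suc zero)) + length (mergeBits A))
            ≡⟨ cong (λ l → suc s + (l + length (mergeBits A))) (length-padded A (suc zero)) ⟩
          suc s + (suc s + length (mergeBits A))
            ≡⟨ +-assoc (suc s) (suc s) _ ⟨
          suc s + suc s + length (mergeBits A)
            ≡⟨ cong (λ l → suc s + l + length (mergeBits A)) (+-identityʳ (suc s)) ⟨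
          2 * suc s + length (mergeBits A)
            ≤⟨ +-monoʳ-≤ (2 * suc s) (m+n≤o⇒m≤o (length (mergeBits A))
                 (length-stream k (cellRanking A) (cellRanking-unique A) n {[]} (_ , refl))) ⟩
          2 * suc s + 2 * n ∎
      ; decode  = split
      ; correct = λ A Q Q₃ → subst (SortedTopK₂ U k A Q) (sym (split-padded A Q))
          (answer-sortedTopK A Q Q₃)
      }
      where
      open ≤-Reasoning
      padded : Array₂ U 2 n → Fin 2 → List Bool
      padded A i = pad s (rowBits A i)
      length-padded : ∀ A i → length (padded A i) ≡ suc s
      length-padded A i = length-pad (rowBits A i) (bounded (rowArray A i))
      take-padded : ∀ A i {bits} → take (suc s) (padded A i ++ bits) ≡ padded A i
      take-padded A i rewrite sym (length-padded A i) = take-length (padded A i)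
      drop-padded : ∀ A i {bits} → drop (suc s) (padded A i ++ bits) ≡ bits
      drop-padded A i rewrite sym (length-padded A i) = drop-length (padded A i)
      split : List Bool → Rectangle 2 n → List (Cell n)
      split bits = answer
        (unpad (take (suc s) bits))
        (unpad (take (suc s) (drop (suc s) bits)))
        (drop (suc s) (drop (suc s) bits))
      split-padded : ∀ A Q → split (padded A zero ++ padded A (suc zero) ++ mergeBits A) Q ≡
                     answer (rowBits A zero) (rowBits A (suc zero)) (mergeBits A) Q
      split-padded A Q
        rewrite take-padded A zero {padded A (suc zero) ++ mergeBits A}
              | drop-padded A zero {padded A (suc zero) ++ mergeBits A}
              | take-padded A (suc zero) {mergeBits A}
              | drop-padded A (suc zero) {mergeBits A}
              | unpad-pad s (rowBits A zero)
              | unpad-pad s (rowBits A (suc zero)) = refl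

-- Arithmetic of the space bound and the final assembly.

-- For one column both sides are 4, since `⌈log₂ 9 ⌉` is 4. From two columns on, `2 + 2 * n` is at
-- most `3 * n`, and `2 ^ 3 = 8` is below `3 ^ 2 = 9`.
2+2n≤⌈2nlg3⌉ : ∀ m → 2 + 2 * suc m ≤ ⌈2 suc m lg3⌉
2+2n≤⌈2nlg3⌉ zero      = ≤-refl
2+2n≤⌈2nlg3⌉ (suc m) = begin
  2 + 2 * n           ≤⟨ +-monoˡ-≤ (2 * n) (s≤s (s≤s z≤n)) ⟩
  3 * n               ≡⟨ ⌈log₂2^n⌉≡n (3 * n) ⟨
  ⌈log₂ 2 ^ (3 * n) ⌉ ≡⟨ cong ⌈log₂_⌉ (^-*-assoc 2 3 n) ⟨
  ⌈log₂ 8 ^ n ⌉       ≤⟨ ⌈log₂⌉-mono-≤ (^-monoˡ-≤ n (n≤1+n 8)) ⟩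
  ⌈log₂ 9 ^ n ⌉       ≡⟨ cong ⌈log₂_⌉ (^-*-assoc 3 2 n) ⟩
  ⌈2 n lg3⌉           ∎
  where
  open ≤-Reasoning
  n = suc (suc m)

weaken : ∀ {a b c} {s t : ℕ} {Array : Set a} {Query Answer : Set}
         {InFamily : Query → Set b} {Correct : Array → Query → Answer → Set c} →
         s ≤ t → Encoding s InFamily Correct → Encoding t InFamily Correct
weaken s≤t E = record
  { encode = encode ; bounded = λ A → ≤-trans (bounded A) s≤t ; decode = decode ; correct = correct }
  where open Encoding E

0-isLittleO : IsLittleO[n] (λ _ → 0)
0-isLittleO ε ε>0 = 0 , λ n _ → ℚₚ.nonNegative⁻¹ (ε ℚ.* (ℤ.+ n ℚ./ 1))
  {{ℚₚ.nonNeg*nonNeg⇒nonNeg ε {{ℚₚ.pos⇒nonNeg ε {{ε>0}}}} (ℤ.+ n ℚ./ 1) {{ℚₚ.normalize-nonNeg n 1}}}}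

theorem3 : ∀ {c ℓ₁ ℓ₂} →
    ∃[ e ] (IsLittleO[n] e ×
    (∀ (U : TotalOrder c ℓ₁ ℓ₂) (S : ℕ → ℕ → ℕ) (n k : ℕ) →
    1 ≤ n → 1 < k → k ≤ 2 * n →
    Sorted1SidedEncoding U n k (S n k) →
    Sorted3SidedEncoding U 2 n k (2 * S n k + ⌈2 n lg3⌉ + e n)))
theorem3 = (λ _ → 0) , 0-isLittleO , λ
  { U S (suc m) k _ _ _ rows → weaken (bound (S (suc m) k) m) (threeSided U rows) }
  where
  open ≤-Reasoning
  bound : ∀ s m → 2 * suc s + 2 * suc m ≤ 2 * s + ⌈2 suc m lg3⌉ + 0
  bound s m = begin
    2 * suc s + 2 * suc m         ≡⟨ cong (_+ 2 * suc m) (trans (*-suc 2 s) (+-comm 2 (2 * s))) ⟩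
    2 * s + 2 + 2 * suc m         ≡⟨ +-assoc (2 * s) 2 (2 * suc m) ⟩
    2 * s + (2 + 2 * suc m)       ≤⟨ +-monoʳ-≤ (2 * s) (2+2n≤⌈2nlg3⌉ m) ⟩
    2 * s + ⌈2 suc m lg3⌉         ≡⟨ +-identityʳ _ ⟨
    2 * s + ⌈2 suc m lg3⌉ + 0     ∎
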